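{- For every integer $n\geq 3$, writing $f_q(n)$ for the total number of occurrences of the pattern $q$ in all permutations of $S_n(132,213)$, we have $$f_{123}(n)=(n-4)2^{n-1}+n+2,$$ $$f_{231}(n)=f_{312}(n)=(n^2-7n+16)2^{n-2}-n-4,$$ $$f_{321}(n)=\left(\frac{n^3}{3}-3n^2+\frac{38n}{3}-24\right)2^{n-2}+n+6.$$
   Context: $S_n$ is the set of permutations of $\{1,\dots,n\}$ written in one-line notation $\sigma=\sigma_1\sigma_2\cdots\sigma_n$. For $q\in S_k$, an occurrence of the pattern $q$ in $\sigma\in S_n$ is a choice of indices $i_1<i_2<\cdots<i_k$ in $\{1,\dots,n\}$ such that for all $1\le j,l\le k$, $q_j<q_l$ if and only if $\sigma_{i_j}<\sigma_{i_l}$. Let $f_q(\sigma)$ be the number of occurrences of $q$ in $\sigma$; $\sigma$ avoids $q$ if $f_q(\sigma)=0$. $S_n(132,213)$ is the set of permutations in $S_n$ avoiding both $132$ and $213$, and $f_q(n)=\sum_{\sigma\in S_n(132,213)}f_q(\sigma)$. -}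

module Defs where

open import Data.Fin using (Fin; _<_; #_)
open import Data.Fin.Properties using (all?; any?; _<?_) renaming (_≟_ to _≟ᶠ_)
open import Data.List using (List; [_]; length; filter; map; allFin; cartesianProductWith)
open import Data.List.Membership.Propositional using (_∈_)
open import Data.List.Membership.Propositional.Properties using (∈-allFin; ∈-cartesianProductWith⁺)
open import Data.List.Relation.Unary.All using ([])
open import Data.List.Relation.Unary.AllPairs using ([]; _∷_)
open import Data.List.Relation.Unary.Any using (here)
open import Data.List.Relation.Unary.Unique.Propositional using (Unique)
open import Data.List.Relation.Unary.Unique.Propositional.Properties using (allFin⁺; cartesianProductWith⁺)
open import Data.Nat using (ℕ; zero; suc)
open import Data.Nat.ListAction using (sum)
import Data.Nat.Properties as ℕ
open import Data.Product using (_×_; _,_)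
open import Data.Vec using (Vec; []; _∷_; lookup)
open import Data.Vec.Properties using (∷-injective)
open import Data.Vec.Relation.Unary.Linked using (Linked; linked?)
open import Function.Bundles using (_⇔_; mk⇔; module Equivalence)
open import Function.Consequences.Propositional using (strictlySurjective⇒surjective; surjective⇒strictlySurjective)
open import Function.Definitions using (Injective; Surjective; Bijective)
open import Relation.Binary.PropositionalEquality using (_≡_; refl)
open import Relation.Nullary using (Dec)
open import Relation.Nullary.Decidable using (map′; _×-dec_; _→-dec_)

private
  variable
    k n : ℕ

-- All k-letter words over Fin n.
words : ∀ n k → List (Vec (Fin n) k)
words n zero    = [ [] ]
words n (suc k) = cartesianProductWith _∷_ (allFin n) (words n k)

-- Each word is listed exactly once, so the length of a filtered `words n k` is
-- the number of words satisfying the predicate.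
∈-words : (w : Vec (Fin n) k) → w ∈ words n k
∈-words []      = here refl
∈-words (x ∷ w) = ∈-cartesianProductWith⁺ _∷_ (∈-allFin x) (∈-words w)

words-unique : ∀ n k → Unique (words n k)
words-unique n zero    = [] ∷ []
words-unique n (suc k) =
  cartesianProductWith⁺ _∷_ ∷-injective (allFin⁺ n) (words-unique n k)

-- One-line notation is shifted to start at 0: the word of σ = σ₁…σₙ has
-- σᵢ₊₁ − 1 at position i.
IsPermutation : Vec (Fin n) n → Set
IsPermutation w = Bijective _≡_ _≡_ (lookup w)

isPermutation? : (w : Vec (Fin n) n) → Dec (IsPermutation w)
isPermutation? w = injective? ×-dec surjective?
  where
  injective? : Dec (Injective _≡_ _≡_ (lookup w))
  injective? = map′ (λ inj {x} {y} → inj x y) (λ inj x y → inj)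
    (all? λ x → all? λ y → (lookup w x ≟ᶠ lookup w y) →-dec (x ≟ᶠ y))

  surjective? : Dec (Surjective _≡_ _≡_ (lookup w))
  surjective? = map′ strictlySurjective⇒surjective surjective⇒strictlySurjective
    (all? λ y → any? λ x → lookup w x ≟ᶠ y)

S : ∀ n → List (Vec (Fin n) n)
S n = filter isPermutation? (words n n)

IsOccurrence : Vec (Fin k) k → Vec (Fin n) n → Vec (Fin n) k → Set
IsOccurrence q σ i =
  Linked _<_ i ×
  (∀ j l → lookup q j < lookup q l ⇔ lookup σ (lookup i j) < lookup σ (lookup i l))

isOccurrence? : (q : Vec (Fin k) k) (σ : Vec (Fin n) n) (i : Vec (Fin n) k) →
                Dec (IsOccurrence q σ i)
isOccurrence? q σ i = linked? _<?_ i ×-dec all? λ j → all? λ l →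
  (lookup q j <? lookup q l) ⇔-dec (lookup σ (lookup i j) <? lookup σ (lookup i l))
  where
  _⇔-dec_ : {A B : Set} → Dec A → Dec B → Dec (A ⇔ B)
  a? ⇔-dec b? = map′ (λ (to , from) → mk⇔ to from)
    (λ e → Equivalence.to e , Equivalence.from e)
    ((a? →-dec b?) ×-dec (b? →-dec a?))

occurrences : Vec (Fin k) k → Vec (Fin n) n → ℕ
occurrences {k} {n} q σ = length (filter (isOccurrence? q σ) (words n k))

Avoids : Vec (Fin n) n → Vec (Fin k) k → Set
Avoids σ q = occurrences q σ ≡ 0

avoids? : (σ : Vec (Fin n) n) (q : Vec (Fin k) k) → Dec (Avoids σ q)
avoids? σ q = occurrences q σ ℕ.≟ 0

p123 p132 p213 p231 p312 p321 : Vec (Fin 3) 3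
p123 = # 0 ∷ # 1 ∷ # 2 ∷ []
p132 = # 0 ∷ # 2 ∷ # 1 ∷ []
p213 = # 1 ∷ # 0 ∷ # 2 ∷ []
p231 = # 1 ∷ # 2 ∷ # 0 ∷ []
p312 = # 2 ∷ # 0 ∷ # 1 ∷ []
p321 = # 2 ∷ # 1 ∷ # 0 ∷ []

S[132,213] : ∀ n → List (Vec (Fin n) n)
S[132,213] n = filter (λ σ → avoids? σ p132 ×-dec avoids? σ p213) (S n)

f : Vec (Fin k) k → ℕ → ℕ
f q n = sum (map (occurrences q) (S[132,213] n))

{-# OPTIONS --safe #-}

-- A permutation is its first entry v followed by a permutation τ whose values ≥ v
-- are raised by one. For it to avoid 132 and 213, τ must avoid both and v must be
-- the maximum or one less than the second entry; hence every avoider of length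
-- n ≥ 1 has exactly two extensions. Under these, the number of (non)inversions, the
-- number of entries larger or smaller than the first, and the number of
-- occurrences of a pattern (in total, or starting at the first entry) change by
-- linear rules, so their sums over all avoiders satisfy a triangular system of
-- recurrences, whose solutions are polynomials in the length and a power of 2.
module Submission where

open import Data.Fin using (Fin; zero; suc)
open import Data.Nat as ℕ using (ℕ; zero; suc; s≤s; _∸_; _^_; _≥_)
import Data.Nat.Properties as ℕ
open import Data.Product using (_×_; _,_)
open import Data.Vec using (Vec; []; _∷_; lookup)
open import Relation.Binary.PropositionalEquality
open import Relation.Nullary.Decidable using (True; toWitness)
open import Defs

module Counting where
  open import Data.Nat using (_+_; _*_; s<s; z<s)
  open import Data.Nat.ListAction using (sum)
  open import Data.Nat.ListAction.Properties using (sum-++; sum-↭)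
  open import Data.Nat.Properties using
    (*-identityʳ; *-identityˡ; *-zeroʳ; *-assoc; +-identityʳ; <-trans; <-asym;
     <-irrefl; <-≤-trans; ≰⇒>; <⇒≱; m+n≡0⇒m≡0; m+n≡0⇒n≡0)
  open import Data.Nat.Solver using (module +-*-Solver)
  open +-*-Solver using (solve; con; _:+_; _:*_; _:=_)
  open import Data.Bool using (if_then_else_)
  open import Data.Fin using (_<_; #_; punchIn; punchOut; fromℕ; inject₁)
  open import Data.Fin.Properties using
    (all?; _≟_; _<?_; <-cmp; 0≢1+n; suc-injective; ≤fromℕ; fromℕ≢inject₁;
     punchIn-mono-≤; punchIn-cancel-≤; punchIn-injective; punchInᵢ≢i; punchIn-punchOut)
  open import Data.Fin.Relation.Unary.Top using (view; ‵fromℕ; ‵inject₁)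
  open import Data.List as List using
    (List; []; _∷_; _++_; length; filter; allFin; tabulate; cartesianProductWith)
  open import Data.List.Membership.Propositional using (_∈_)
  open import Data.List.Membership.Propositional.Properties using
    (∈-map⁺; ∈-map⁻; ∈-++⁺ˡ; ∈-++⁺ʳ; ∈-++⁻; ∈-filter⁺; ∈-filter⁻)
  open import Data.List.Membership.Propositional.Properties.WithK using (unique∧set⇒bag)
  open import Data.List.Properties using (map-++; map-∘; map-cong; map-tabulate; map-cong-local)
  open import Data.List.Relation.Binary.BagAndSetEquality using (∼bag⇒↭)
  open import Data.List.Relation.Binary.Permutation.Propositional using (_↭_)
  open import Data.List.Relation.Binary.Permutation.Propositional.Properties using (map⁺)
  import Data.List.Relation.Unary.All as ListAll
  import Data.List.Relation.Unary.AllPairs as AllPairs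
  open import Data.List.Relation.Unary.Any using (here)
  open import Data.List.Relation.Unary.Unique.Propositional using (Unique)
  import Data.List.Relation.Unary.Unique.Propositional.Properties as Unique
  open import Data.Product using (proj₁; proj₂; ∃)
  open import Data.Sum using (_⊎_; inj₁; inj₂)
  open import Data.Vec using (head; tail; map)
  open import Data.Vec.Properties using (lookup-map; ∷-injectiveˡ; ∷-injectiveʳ)
  open import Data.Vec.Relation.Unary.All as All using (All; []; _∷_)
  import Data.Vec.Relation.Unary.All.Properties as All
  open import Data.Vec.Relation.Unary.Linked using ([-]; _∷_)
  open import Function using (_∘_; flip)
  open import Function.Bundles using (_⇔_; mk⇔; module Equivalence)
  open import Function.Consequences.Propositional using
    (strictlySurjective⇒surjective; surjective⇒strictlySurjective)
  open import Relation.Binary using (tri<; tri≈; tri>)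
  open import Relation.Nullary using (Dec; does; yes; no; ¬_; contradiction)
  open import Relation.Nullary.Decidable using (_×-dec_)
  open import Relation.Unary using (Pred; Decidable)

  private
    variable
      k m n : ℕ
      A B C P Q : Set

  -- Indicators and sums over increasing positions.

  𝟙 : Dec P → ℕ
  𝟙 p? = if does p? then 1 else 0

  𝟙-true : (p? : Dec P) → P → 𝟙 p? ≡ 1
  𝟙-true (yes _) _ = refl
  𝟙-true (no ¬p) p = contradiction p ¬p

  𝟙-false : (p? : Dec P) → ¬ P → 𝟙 p? ≡ 0
  𝟙-false (yes p) ¬p = contradiction p ¬p
  𝟙-false (no _)  _  = refl

  𝟙-cong : (p? : Dec P) (q? : Dec Q) → P ⇔ Q → 𝟙 p? ≡ 𝟙 q?
  𝟙-cong (yes p) q? P⇔Q = sym (𝟙-true q? (Equivalence.to P⇔Q p))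
  𝟙-cong (no ¬p) q? P⇔Q = sym (𝟙-false q? (¬p ∘ Equivalence.from P⇔Q))

  𝟙-× : (p? : Dec P) (q? : Dec Q) → 𝟙 (p? ×-dec q?) ≡ 𝟙 p? * 𝟙 q?
  𝟙-× (yes _) (yes _) = refl
  𝟙-× (yes _) (no _)  = refl
  𝟙-× (no _)  _       = refl

  lt : Fin n → Fin n → ℕ
  lt x y = 𝟙 (x <? y)

  sum₁ : (A → ℕ) → Vec A n → ℕ
  sum₁ h []       = 0
  sum₁ h (x ∷ xs) = h x + sum₁ h xs

  sum₂ : (A → A → ℕ) → Vec A n → ℕ
  sum₂ h []       = 0
  sum₂ h (x ∷ xs) = sum₁ (h x) xs + sum₂ h xs

  sum₃ : (A → A → A → ℕ) → Vec A n → ℕ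
  sum₃ h []       = 0
  sum₃ h (x ∷ xs) = sum₂ (h x) xs + sum₃ h xs

  ∑ : (Fin n → ℕ) → ℕ
  ∑ h = sum (tabulate h)

  ∑-cong : ∀ n {g h : Fin n → ℕ} → g ≗ h → ∑ g ≡ ∑ h
  ∑-cong zero    e = refl
  ∑-cong (suc n) e = cong₂ _+_ (e zero) (∑-cong n (e ∘ suc))

  ∑-zero : ∀ n {h : Fin n → ℕ} → (∀ i → h i ≡ 0) → ∑ h ≡ 0
  ∑-zero zero    e = refl
  ∑-zero (suc n) e = cong₂ _+_ (e zero) (∑-zero n (e ∘ suc))

  ∑-sum₁ : (h : A → ℕ) (xs : Vec A n) → ∑ (λ i → h (lookup xs i)) ≡ sum₁ h xs
  ∑-sum₁ h []       = refl
  ∑-sum₁ h (x ∷ xs) = cong (h x +_) (∑-sum₁ h xs)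

  -- Peel off position 0: `lt zero (suc j)` computes to 1 and `lt i zero` to 0, so the terms with i
  -- = 0 give `sum₁ (h x) xs` and the others are the double sum for the tail.
  ∑-sum₂ : (h : A → A → ℕ) (xs : Vec A n) →
           ∑ (λ i → ∑ λ j → lt i j * h (lookup xs i) (lookup xs j)) ≡ sum₂ h xs
  ∑-sum₂ h []                   = refl
  ∑-sum₂ {n = suc n} h (x ∷ xs) = cong₂ _+_
    (trans (∑-cong n λ _ → *-identityˡ _) (∑-sum₁ (h x) xs))
    (∑-sum₂ h xs)

  ∑-sum₃ : (h : A → A → A → ℕ) (xs : Vec A n) →
           ∑ (λ i → ∑ λ j → ∑ λ k →
                lt i j * (lt j k * h (lookup xs i) (lookup xs j) (lookup xs k))) ≡
           sum₃ h xs
  ∑-sum₃ h []                   = refl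
  ∑-sum₃ {n = suc n} h (x ∷ xs) = cong₂ _+_
    (cong₂ _+_ (∑-zero n λ _ → refl)
      (trans (∑-cong n λ j → ∑-cong n λ k → *-identityˡ _) (∑-sum₂ (h x) xs)))
    -- For positive i, the terms with j = 0 vanish because of the factor `lt i j`, those with k = 0
    -- because of `lt j k`.
    (trans (∑-cong n λ i → cong₂ _+_ (∑-zero n λ _ → refl)
              (∑-cong n λ j → cong₂ _+_ (*-zeroʳ (lt i j)) refl))
      (∑-sum₃ h xs))

  -- Counting words by summing indicators.

  length-filter : {P : Pred A _} (P? : Decidable P) (xs : List A) →
                  length (filter P? xs) ≡ sum (List.map (𝟙 ∘ P?) xs)
  length-filter P? []       = refl
  length-filter P? (x ∷ xs) with P? x
  ... | yes _ = cong suc (length-filter P? xs)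
  ... | no _  = length-filter P? xs

  sum-cartesianProductWith :
    (_∙_ : A → B → C) (h : C → ℕ) (xs : List A) (ys : List B) →
    sum (List.map h (cartesianProductWith _∙_ xs ys)) ≡
    sum (List.map (λ x → sum (List.map (λ y → h (x ∙ y)) ys)) xs)
  sum-cartesianProductWith _∙_ h []       ys = refl
  sum-cartesianProductWith _∙_ h (x ∷ xs) ys
    rewrite map-++ h (List.map (x ∙_) ys) (cartesianProductWith _∙_ xs ys)
          | sum-++ (List.map h (List.map (x ∙_) ys))
                   (List.map h (cartesianProductWith _∙_ xs ys))
    = cong₂ _+_ (cong sum (sym (map-∘ ys))) (sum-cartesianProductWith _∙_ h xs ys)

  sum-words-suc : (h : Vec (Fin n) (suc k) → ℕ) →
                  sum (List.map h (words n (suc k))) ≡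
                  ∑ (λ x → sum (List.map (λ w → h (x ∷ w)) (words n k)))
  sum-words-suc {n} {k} h =
    trans (sum-cartesianProductWith _∷_ h (allFin n) (words n k))
          (cong sum (map-tabulate {n = n} (λ x → x) _))

  sum-words-3 : (h : Vec (Fin n) 3 → ℕ) →
                sum (List.map h (words n 3)) ≡
                ∑ (λ x → ∑ λ y → ∑ λ z → h (x ∷ y ∷ z ∷ []))
  sum-words-3 {n} h =
    trans (sum-words-suc h) (∑-cong n λ x →
    trans (sum-words-suc λ w → h (x ∷ w)) (∑-cong n λ y →
    trans (sum-words-suc λ w → h (x ∷ y ∷ w)) (∑-cong n λ z → +-identityʳ _)))

  -- Pattern occurrences as triple sums.

  -- The argument p is the inverse of the pattern: its entries are the positions of
  -- the smallest, middle and largest letter.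
  χ : Vec (Fin 3) 3 → Fin n → Fin n → Fin n → ℕ
  χ p a b c = lt (u (# 0)) (u (# 1)) * lt (u (# 1)) (u (# 2))
    where u = λ i → lookup (a ∷ b ∷ c ∷ []) (lookup p i)

  -- Two comparisons suffice for all nine equivalences in `IsOccurrence`: `v` is strictly monotone
  -- by transitivity, and it reflects the order by trichotomy.
  increasing-embeds : (v : Fin 3 → Fin n) → v (# 0) < v (# 1) → v (# 1) < v (# 2) →
                      ∀ x y → x < y ⇔ v x < v y
  increasing-embeds v p q x y = mk⇔ (mono x y) cancel
    where
    mono : ∀ x y → x < y → v x < v y
    mono zero zero ()
    mono zero (suc zero) _ = p
    mono zero (suc (suc zero)) _ = <-trans p q
    mono (suc zero) (suc (suc zero)) _ = q
    mono (suc zero) (suc zero) (s≤s ())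
    mono (suc (suc zero)) (suc (suc zero)) (s≤s (s≤s ()))
    mono (suc (suc zero)) (suc zero) (s≤s ())
    cancel : v x < v y → x < y
    cancel vx<vy with <-cmp x y
    ... | tri< x<y _ _ = x<y
    ... | tri≈ _ refl _ = contradiction vx<vy (<-irrefl refl)
    ... | tri> _ _ y<x = contradiction (mono y x y<x) (<-asym vx<vy)

  Inverse : Vec (Fin 3) 3 → Vec (Fin 3) 3 → Set
  Inverse q p = (∀ i → lookup p (lookup q i) ≡ i) × (∀ i → lookup q (lookup p i) ≡ i)

  -- For concrete patterns this evaluates, so the implicit argument `True (inverse? q p)` is filled
  -- in automatically.
  inverse? : ∀ q p → Dec (Inverse q p)
  inverse? q p = all? (λ i → lookup p (lookup q i) ≟ i) ×-dec all? (λ i → lookup q (lookup p i) ≟ i)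

  module _ (q p : Vec (Fin 3) 3) {inverse : True (inverse? q p)} where
    private
      pq : ∀ i → lookup p (lookup q i) ≡ i
      pq = proj₁ (toWitness inverse)

      qp : ∀ i → lookup q (lookup p i) ≡ i
      qp = proj₂ (toWitness inverse)

    -- Read through the inverse `p`, the three chosen letters appear in the order of size that `q`
    -- prescribes, so being order-isomorphic to `q` means that this reading increases.
    occurrence⇔chain : (σ : Vec (Fin n) n) (i j k : Fin n) → let
        u = λ x → lookup (lookup σ i ∷ lookup σ j ∷ lookup σ k ∷ []) (lookup p x)
      in
      IsOccurrence q σ (i ∷ j ∷ k ∷ []) ⇔
      ((i < j × j < k) × (u (# 0) < u (# 1) × u (# 1) < u (# 2)))
    occurrence⇔chain {n} σ i j k = mk⇔ to from
      where
      s s′ : Fin 3 → Fin n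
      s x = lookup σ (lookup (i ∷ j ∷ k ∷ []) x)
      s′ x = lookup (lookup σ i ∷ lookup σ j ∷ lookup σ k ∷ []) x
      s≗s′ : s ≗ s′
      s≗s′ zero = refl
      s≗s′ (suc zero) = refl
      s≗s′ (suc (suc zero)) = refl
      step : (∀ x y → lookup q x < lookup q y ⇔ s x < s y) →
             ∀ x y → x < y → s′ (lookup p x) < s′ (lookup p y)
      step e x y x<y = subst₂ _<_ (s≗s′ (lookup p x)) (s≗s′ (lookup p y))
        (Equivalence.to (e (lookup p x) (lookup p y))
          (subst₂ _<_ (sym (qp x)) (sym (qp y)) x<y))
      to : IsOccurrence q σ (i ∷ j ∷ k ∷ []) → _
      to (i<j ∷ j<k ∷ [-] , e) =
        (i<j , j<k) , (step e (# 0) (# 1) z<s , step e (# 1) (# 2) (s<s z<s))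
      from : _ → IsOccurrence q σ (i ∷ j ∷ k ∷ [])
      from ((i<j , j<k) , (c , d)) = i<j ∷ j<k ∷ [-] , λ x y →
        subst₂ (λ a b → lookup q x < lookup q y ⇔ a < b) (back x) (back y)
          (increasing-embeds (s′ ∘ lookup p) c d (lookup q x) (lookup q y))
        where
        back : ∀ x → s′ (lookup p (lookup q x)) ≡ s x
        back x = trans (cong s′ (pq x)) (sym (s≗s′ x))

    -- The indicator of an occurrence factors into `lt i j`, `lt j k` and `χ`, the shape that
    -- `∑-sum₃` collapses into a recursive sum.
    occurrences≡sum₃ : (σ : Vec (Fin n) n) → occurrences q σ ≡ sum₃ (χ p) σ
    occurrences≡sum₃ {n} σ = trans (length-filter (isOccurrence? q σ) (words n 3))
      (trans (sum-words-3 (𝟙 ∘ isOccurrence? q σ))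
      (trans (∑-cong n λ i → ∑-cong n λ j → ∑-cong n λ k → indicator i j k)
             (∑-sum₃ (χ p) σ)))
      where
      indicator : ∀ i j k → 𝟙 (isOccurrence? q σ (i ∷ j ∷ k ∷ [])) ≡
        lt i j * (lt j k * χ p (lookup σ i) (lookup σ j) (lookup σ k))
      indicator i j k =
        trans (𝟙-cong (isOccurrence? q σ (i ∷ j ∷ k ∷ [])) (ij? ×-dec u?) (occurrence⇔chain σ i j k))
        (trans (𝟙-× ij? u?)
        (trans (cong₂ _*_ (𝟙-× (i <? j) (j <? k)) (𝟙-× (u (# 0) <? u (# 1)) (u (# 1) <? u (# 2))))
               (*-assoc (lt i j) (lt j k) _)))
        where
        u = λ x → lookup (lookup σ i ∷ lookup σ j ∷ lookup σ k ∷ []) (lookup p x)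
        ij? = (i <? j) ×-dec (j <? k)
        u? = (u (# 0) <? u (# 1)) ×-dec (u (# 1) <? u (# 2))

  -- Comparisons after raising values.

  lt-irrefl : (x : Fin n) → lt x x ≡ 0
  lt-irrefl x = 𝟙-false (x <? x) (<-irrefl refl)

  lt-asym : (x y : Fin n) → lt x y * lt y x ≡ 0
  lt-asym x y with <-cmp x y
  ... | tri< _ _ y≮x = trans (cong (lt x y *_) (𝟙-false (y <? x) y≮x)) (*-zeroʳ (lt x y))
  ... | tri≈ x≮y _ _ = cong (_* lt y x) (𝟙-false (x <? y) x≮y)
  ... | tri> x≮y _ _ = cong (_* lt y x) (𝟙-false (x <? y) x≮y)

  lt-fromℕ : (x : Fin (suc n)) → lt (fromℕ n) x ≡ 0
  lt-fromℕ x = 𝟙-false (fromℕ _ <? x) λ max<x → <-irrefl refl (<-≤-trans max<x (≤fromℕ x))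

  punchIn-fromℕ-< : (x : Fin n) → lt (punchIn (fromℕ n) x) (fromℕ n) ≡ 1
  punchIn-fromℕ-< zero    = refl
  punchIn-fromℕ-< (suc x) = punchIn-fromℕ-< x

  lt-punchIn : (v : Fin (suc n)) (x y : Fin n) → lt (punchIn v x) (punchIn v y) ≡ lt x y
  lt-punchIn v x y = 𝟙-cong (punchIn v x <? punchIn v y) (x <? y) (mk⇔
    (λ p → ≰⇒> λ y≤x → <⇒≱ p (punchIn-mono-≤ v y x y≤x))
    (λ p → ≰⇒> λ y≤x → <⇒≱ p (punchIn-cancel-≤ v y x y≤x)))

  -- With `v = inject₁ t`, the value `t` and all larger ones are raised, so `v` lies directly below
  -- the raised `t`. Any other value compares with `v` as it did with `t`, whereas `t` itself now
  -- exceeds `v`; the next two lemmas complete the case distinction.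
  lt-punchIn-inject₁ : (t x : Fin n) → lt (punchIn (inject₁ t) x) (inject₁ t) ≡ lt x t
  lt-punchIn-inject₁ zero    zero    = refl
  lt-punchIn-inject₁ zero    (suc x) = refl
  lt-punchIn-inject₁ (suc t) zero    = refl
  lt-punchIn-inject₁ (suc t) (suc x) = lt-punchIn-inject₁ t x

  lt-inject₁-punchIn-refl : (t : Fin n) → lt (inject₁ t) (punchIn (inject₁ t) t) ≡ 1
  lt-inject₁-punchIn-refl zero    = refl
  lt-inject₁-punchIn-refl (suc t) = lt-inject₁-punchIn-refl t

  lt-inject₁-punchIn : (t x : Fin n) → t ≢ x → lt (inject₁ t) (punchIn (inject₁ t) x) ≡ lt t x
  lt-inject₁-punchIn zero    zero    t≢x = contradiction refl t≢x
  lt-inject₁-punchIn zero    (suc x) t≢x = refl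
  lt-inject₁-punchIn (suc t) zero    t≢x = refl
  lt-inject₁-punchIn (suc t) (suc x) t≢x = lt-inject₁-punchIn t x (t≢x ∘ cong suc)

  -- Rules for sums over subsequences.

  sum₁-cong : {g h : A → ℕ} {xs : Vec A n} → All (λ x → g x ≡ h x) xs → sum₁ g xs ≡ sum₁ h xs
  sum₁-cong []       = refl
  sum₁-cong (e ∷ es) = cong₂ _+_ e (sum₁-cong es)

  sum₂-cong : {P : A → Set} {g h : A → A → ℕ} {xs : Vec A n} →
              (∀ {x y} → P x → P y → g x y ≡ h x y) → All P xs → sum₂ g xs ≡ sum₂ h xs
  sum₂-cong e []       = refl
  sum₂-cong e (p ∷ ps) = cong₂ _+_ (sum₁-cong (All.map (e p) ps)) (sum₂-cong e ps)

  sum₁-≗ : {g h : A → ℕ} → g ≗ h → (xs : Vec A n) → sum₁ g xs ≡ sum₁ h xs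
  sum₁-≗ e xs = sum₁-cong (All.universal e xs)

  sum₂-≗ : {g h : A → A → ℕ} → (∀ x y → g x y ≡ h x y) → (xs : Vec A n) → sum₂ g xs ≡ sum₂ h xs
  sum₂-≗ e []       = refl
  sum₂-≗ e (x ∷ xs) = cong₂ _+_ (sum₁-≗ (e x) xs) (sum₂-≗ e xs)

  sum₃-≗ : {g h : A → A → A → ℕ} → (∀ x y z → g x y z ≡ h x y z) →
           (xs : Vec A n) → sum₃ g xs ≡ sum₃ h xs
  sum₃-≗ e []       = refl
  sum₃-≗ e (x ∷ xs) = cong₂ _+_ (sum₂-≗ (e x) xs) (sum₃-≗ e xs)

  sum₁-map : (g : A → B) (h : B → ℕ) (xs : Vec A n) → sum₁ h (map g xs) ≡ sum₁ (h ∘ g) xs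
  sum₁-map g h []       = refl
  sum₁-map g h (x ∷ xs) = cong (h (g x) +_) (sum₁-map g h xs)

  sum₂-map : (g : A → B) (h : B → B → ℕ) (xs : Vec A n) →
             sum₂ h (map g xs) ≡ sum₂ (λ x y → h (g x) (g y)) xs
  sum₂-map g h []       = refl
  sum₂-map g h (x ∷ xs) = cong₂ _+_ (sum₁-map g (h (g x)) xs) (sum₂-map g h xs)

  sum₃-map : (g : A → B) (h : B → B → B → ℕ) (xs : Vec A n) →
             sum₃ h (map g xs) ≡ sum₃ (λ x y z → h (g x) (g y) (g z)) xs
  sum₃-map g h []       = refl
  sum₃-map g h (x ∷ xs) = cong₂ _+_ (sum₂-map g (h (g x)) xs) (sum₃-map g h xs)

  sum₁-const : ∀ c (xs : Vec A n) → sum₁ (λ _ → c) xs ≡ n * c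
  sum₁-const c []       = refl
  sum₁-const c (x ∷ xs) = cong (c +_) (sum₁-const c xs)

  sum₁-0 : {h : A → ℕ} → (∀ x → h x ≡ 0) → (xs : Vec A n) → sum₁ h xs ≡ 0
  sum₁-0 e []       = refl
  sum₁-0 e (x ∷ xs) = cong₂ _+_ (e x) (sum₁-0 e xs)

  sum₂-0 : {h : A → A → ℕ} → (∀ x y → h x y ≡ 0) → (xs : Vec A n) → sum₂ h xs ≡ 0
  sum₂-0 e []       = refl
  sum₂-0 e (x ∷ xs) = cong₂ _+_ (sum₁-0 (e x) xs) (sum₂-0 e xs)

  sum₁≡0⇒ : (h : A → ℕ) (xs : Vec A n) → sum₁ h xs ≡ 0 → ∀ i → h (lookup xs i) ≡ 0
  sum₁≡0⇒ h (x ∷ xs) e zero    = m+n≡0⇒m≡0 _ e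
  sum₁≡0⇒ h (x ∷ xs) e (suc i) = sum₁≡0⇒ h xs (m+n≡0⇒n≡0 (h x) e) i

  -- Prepending an entry to a permutation.

  infixr 5 _▸_
  _▸_ : Fin (suc n) → Vec (Fin n) k → Vec (Fin (suc n)) (suc k)
  v ▸ τ = v ∷ map (punchIn v) τ

  -- The first entries are arbitrary, so this one lemma gives the injectivity of both `maxFirst` and
  -- `predFirst`.
  ▸-injective : {v w : Fin (suc n)} {τ ρ : Vec (Fin n) k} → v ▸ τ ≡ w ▸ ρ → τ ≡ ρ
  ▸-injective {v = v} e with refl ← ∷-injectiveˡ e = map-punchIn-injective _ _ (∷-injectiveʳ e)
    where
    map-punchIn-injective : ∀ {k} (τ ρ : Vec _ k) → map (punchIn v) τ ≡ map (punchIn v) ρ → τ ≡ ρ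
    map-punchIn-injective []      []      _ = refl
    map-punchIn-injective (x ∷ τ) (y ∷ ρ) e =
      cong₂ _∷_ (punchIn-injective v x y (∷-injectiveˡ e)) (map-punchIn-injective τ ρ (∷-injectiveʳ e))

  lookup-▸ : (v : Fin (suc n)) (τ : Vec (Fin n) k) (i : Fin k) →
             lookup (v ▸ τ) (suc i) ≡ punchIn v (lookup τ i)
  lookup-▸ v τ i = lookup-map i (punchIn v) τ

  ▸-isPermutation : {v : Fin (suc n)} {τ : Vec (Fin n) n} → IsPermutation τ → IsPermutation (v ▸ τ)
  ▸-isPermutation {n} {v} {τ} (inj , surj) = inj′ , strictlySurjective⇒surjective surj′
    where
    inj′ : ∀ {i j} → lookup (v ▸ τ) i ≡ lookup (v ▸ τ) j → i ≡ j
    inj′ {zero}  {zero}  _ = refl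
    inj′ {zero}  {suc j} e = contradiction (sym (trans e (lookup-▸ v τ j))) (punchInᵢ≢i v _)
    inj′ {suc i} {zero}  e = contradiction (trans (sym (lookup-▸ v τ i)) e) (punchInᵢ≢i v _)
    inj′ {suc i} {suc j} e = cong suc (inj (punchIn-injective v _ _
      (trans (sym (lookup-▸ v τ i)) (trans e (lookup-▸ v τ j)))))
    surj′ : ∀ y → ∃ λ i → lookup (v ▸ τ) i ≡ y
    surj′ y with v ≟ y
    ... | yes v≡y = zero , v≡y
    ... | no v≢y with i , e ← surjective⇒strictlySurjective surj (punchOut v≢y) =
      suc i , trans (lookup-▸ v τ i) (trans (cong (punchIn v) e) (punchIn-punchOut v≢y))

  ▸-isPermutation⁻ : {v : Fin (suc n)} {τ : Vec (Fin n) n} → IsPermutation (v ▸ τ) → IsPermutation τ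
  ▸-isPermutation⁻ {n} {v} {τ} (inj , surj) = inj′ , strictlySurjective⇒surjective surj′
    where
    inj′ : ∀ {i j} → lookup τ i ≡ lookup τ j → i ≡ j
    inj′ {i} {j} e = suc-injective (inj
      (trans (lookup-▸ v τ i) (trans (cong (punchIn v) e) (sym (lookup-▸ v τ j)))))
    surj′ : ∀ y → ∃ λ i → lookup τ i ≡ y
    surj′ y with surjective⇒strictlySurjective surj (punchIn v y)
    ... | zero  , e = contradiction (sym e) (punchInᵢ≢i v y)
    ... | suc i , e = i , punchIn-injective v _ _ (trans (sym (lookup-▸ v τ i)) e)

  punchOut-all : (v : Fin (suc n)) (xs : Vec (Fin (suc n)) k) → (∀ i → v ≢ lookup xs i) →
                 ∃ λ τ → xs ≡ map (punchIn v) τ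
  punchOut-all v []       v∉ = [] , refl
  punchOut-all v (x ∷ xs) v∉ with τ , e ← punchOut-all v xs (v∉ ∘ suc) =
    punchOut (v∉ zero) ∷ τ , cong₂ _∷_ (sym (punchIn-punchOut (v∉ zero))) e

  -- By injectivity the first entry does not recur, so it can be punched out of all the others.
  isPermutation⇒▸ : (σ : Vec (Fin (suc n)) (suc n)) → IsPermutation σ → ∃ λ τ → σ ≡ head σ ▸ τ
  isPermutation⇒▸ (v ∷ xs) (inj , _)
    with τ , e ← punchOut-all v xs (λ i e → 0≢1+n (inj {zero} {suc i} e)) =
    τ , cong (v ∷_) e

  -- Supplies the hypothesis under which all later entries compare with `inject₁ (head τ)` as they
  -- do with `head τ`.
  head∉tail : {τ : Vec (Fin n) (suc k)} → (∀ {i j} → lookup τ i ≡ lookup τ j → i ≡ j) →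
              All (head τ ≢_) (tail τ)
  head∉tail {τ = t ∷ ρ} inj = All.lookup⁻ λ i e → 0≢1+n (inj {zero} {suc i} e)

  -- Statistics split along the first entry.

  χ-cong : ∀ p {a b c : Fin m} {a′ b′ c′ : Fin n} →
           (∀ x y → lt (lookup (a ∷ b ∷ c ∷ []) x) (lookup (a ∷ b ∷ c ∷ []) y) ≡
                    lt (lookup (a′ ∷ b′ ∷ c′ ∷ []) x) (lookup (a′ ∷ b′ ∷ c′ ∷ []) y)) →
           χ p a b c ≡ χ p a′ b′ c′
  χ-cong p e = cong₂ _*_ (e (lookup p (# 0)) (lookup p (# 1))) (e (lookup p (# 1)) (lookup p (# 2)))

  χ-punchIn : ∀ p (v : Fin (suc n)) (a b c : Fin n) →
              χ p (punchIn v a) (punchIn v b) (punchIn v c) ≡ χ p a b c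
  χ-punchIn p v a b c = cong₂ _*_ (step (# 0) (# 1)) (step (# 1) (# 2))
    where
    w = a ∷ b ∷ c ∷ []
    step : ∀ x y → lt (lookup (map (punchIn v) w) (lookup p x)) (lookup (map (punchIn v) w) (lookup p y)) ≡
                   lt (lookup w (lookup p x)) (lookup w (lookup p y))
    step x y = trans (cong₂ lt (lookup-map (lookup p x) (punchIn v) w) (lookup-map (lookup p y) (punchIn v) w))
                     (lt-punchIn v _ _)

  -- Only comparisons matter to `χ`, so the entry that `predFirst` adds can replace the old first
  -- entry in every triple whose other two letters differ from it.
  χ-inject₁ : ∀ p (t a b : Fin n) → t ≢ a → t ≢ b →
              χ p (inject₁ t) (punchIn (inject₁ t) a) (punchIn (inject₁ t) b) ≡ χ p t a b
  χ-inject₁ p t a b t≢a t≢b = χ-cong p λ where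
      zero             zero             → trans (lt-irrefl v) (sym (lt-irrefl t))
      zero             (suc zero)       → lt-inject₁-punchIn t a t≢a
      zero             (suc (suc zero)) → lt-inject₁-punchIn t b t≢b
      (suc zero)       zero             → lt-punchIn-inject₁ t a
      (suc zero)       (suc zero)       → lt-punchIn v a a
      (suc zero)       (suc (suc zero)) → lt-punchIn v a b
      (suc (suc zero)) zero             → lt-punchIn-inject₁ t b
      (suc (suc zero)) (suc zero)       → lt-punchIn v b a
      (suc (suc zero)) (suc (suc zero)) → lt-punchIn v b b
    where v = inject₁ t

  -- Occurrences that use the first entry.
  first : Vec (Fin 3) 3 → Vec (Fin n) (suc k) → ℕ
  first p σ = sum₂ (χ p (head σ)) (tail σ)

  larger smaller : Vec (Fin n) (suc k) → ℕ
  larger σ = sum₁ (lt (head σ)) (tail σ)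
  smaller σ = sum₁ (flip lt (head σ)) (tail σ)

  noninversions inversions : Vec (Fin n) k → ℕ
  noninversions  = sum₂ lt
  inversions = sum₂ (flip lt)

  -- Pairs that miss the first entry lie in the raised `τ`, and raising changes no comparison. The
  -- next two lemmas hold for the same reason.
  noninversions-▸ : (v : Fin (suc n)) (τ : Vec (Fin n) k) →
                    noninversions (v ▸ τ) ≡ larger (v ▸ τ) + noninversions τ
  noninversions-▸ v τ = cong (larger (v ▸ τ) +_) (trans (sum₂-map _ lt τ) (sum₂-≗ (lt-punchIn v) τ))

  inversions-▸ : (v : Fin (suc n)) (τ : Vec (Fin n) k) →
                 inversions (v ▸ τ) ≡ smaller (v ▸ τ) + inversions τ
  inversions-▸ v τ = cong (smaller (v ▸ τ) +_)
    (trans (sum₂-map _ (flip lt) τ) (sum₂-≗ (flip (lt-punchIn v)) τ))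

  sum₃-▸ : ∀ p (v : Fin (suc n)) (τ : Vec (Fin n) k) →
           sum₃ (χ p) (v ▸ τ) ≡ first p (v ▸ τ) + sum₃ (χ p) τ
  sum₃-▸ p v τ = cong (first p (v ▸ τ) +_) (trans (sum₃-map _ (χ p) τ) (sum₃-≗ (χ-punchIn p v) τ))

  -- Effect of the two extensions on the statistics.

  maxFirst predFirst : Vec (Fin (suc n)) (suc k) → Vec (Fin (suc (suc n))) (suc (suc k))
  maxFirst τ = fromℕ _ ▸ τ
  predFirst τ = inject₁ (head τ) ▸ τ

  larger-max : (τ : Vec (Fin (suc n)) (suc k)) → larger (maxFirst τ) ≡ 0
  larger-max τ = sum₁-0 lt-fromℕ (map _ τ)

  smaller-max : (τ : Vec (Fin (suc n)) (suc k)) → smaller (maxFirst τ) ≡ suc k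
  smaller-max {k = k} τ = trans (sum₁-map _ _ τ) (trans (sum₁-≗ punchIn-fromℕ-< τ)
    (trans (sum₁-const 1 τ) (*-identityʳ (suc k))))

  -- The additional larger entry is the old first entry, which is raised just above the new one.
  larger-pred : (τ : Vec (Fin (suc n)) (suc k)) → All (head τ ≢_) (tail τ) →
                larger (predFirst τ) ≡ suc (larger τ)
  larger-pred (t ∷ ρ) t∉ρ = cong₂ _+_ (lt-inject₁-punchIn-refl t)
    (trans (sum₁-map _ _ ρ) (sum₁-cong (All.map (λ {x} → lt-inject₁-punchIn t x) t∉ρ)))

  smaller-pred : (τ : Vec (Fin (suc n)) (suc k)) → smaller (predFirst τ) ≡ smaller τ
  smaller-pred (t ∷ ρ) = cong₂ _+_ (trans (lt-punchIn-inject₁ t t) (lt-irrefl t))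
    (trans (sum₁-map _ _ ρ) (sum₁-≗ (lt-punchIn-inject₁ t) ρ))

  module _ (τ : Vec (Fin (suc n)) (suc k)) where
    private
      v = fromℕ (suc n)
      g = punchIn v
      first-max : ∀ p (h : Fin (suc n) → Fin (suc n) → ℕ) →
              (∀ a b → χ p v (g a) (g b) ≡ h a b) →
              first p (maxFirst τ) ≡ sum₂ h τ
      first-max p h e = trans (sum₂-map g _ τ) (sum₂-≗ e τ)

    -- A maximal first entry can only be the largest letter, so none of the patterns starting with 1
    -- or 2 can begin there.
    first-max-123 : first p123 (maxFirst τ) ≡ 0
    first-max-123 = sum₂-0 (λ a b → cong (_* lt a b) (lt-fromℕ a)) (map _ τ)

    first-max-132 : first p132 (maxFirst τ) ≡ 0
    first-max-132 = sum₂-0 (λ a b → cong (_* lt b a) (lt-fromℕ b)) (map _ τ)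

    first-max-213 : first p213 (maxFirst τ) ≡ 0
    first-max-213 = sum₂-0 (λ a b → trans (cong (lt a v *_) (lt-fromℕ b)) (*-zeroʳ (lt a v))) (map _ τ)

    -- Because `χ` takes the inverse pattern, `first p312` counts 231 and `first p231` counts 312;
    -- the other four patterns are their own inverses.
    first-max-231 : first p312 (maxFirst τ) ≡ 0
    first-max-231 = sum₂-0 (λ a b → trans (cong (lt b v *_) (lt-fromℕ a)) (*-zeroʳ (lt b v))) (map _ τ)

    -- With the maximum as the letter 3, each noninversion of `τ` completes a 312, and below each
    -- inversion completes a 321.
    first-max-312 : first p231 (maxFirst τ) ≡ noninversions τ
    first-max-312 = first-max p231 lt λ a b →
      trans (cong₂ _*_ (lt-punchIn v a b) (punchIn-fromℕ-< b)) (*-identityʳ _)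

    first-max-321 : first p321 (maxFirst τ) ≡ inversions τ
    first-max-321 = first-max p321 (flip lt) λ a b →
      trans (cong₂ _*_ (lt-punchIn v b a) (punchIn-fromℕ-< a)) (*-identityʳ _)

  module _ (t : Fin (suc n)) (ρ : Vec (Fin (suc n)) k) (t∉ρ : All (t ≢_) ρ) where
    private
      τ = t ∷ ρ
      v = inject₁ t
      g = punchIn v

      v<gt = lt-inject₁-punchIn-refl t
      gt<v = trans (lt-punchIn-inject₁ t t) (lt-irrefl t)

      -- An occurrence through the new entry either has the raised `t` as its second letter, which
      -- `h` counts, or misses it and corresponds to an occurrence in `τ` that starts at `t`.
      first-pred : ∀ p (h : Fin (suc n) → ℕ) → (∀ b → t ≢ b → χ p v (g t) (g b) ≡ h b) →
              first p (predFirst τ) ≡ sum₁ h ρ + first p τ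
      first-pred p h e = cong₂ _+_
        (trans (sum₁-map g _ ρ) (sum₁-cong (All.map (λ {b} → e b) t∉ρ)))
        (trans (sum₂-map g _ ρ) (sum₂-cong (λ {a} {b} → χ-inject₁ p t a b) t∉ρ))

      first-pred-0 : ∀ p → (∀ b → t ≢ b → χ p v (g t) (g b) ≡ 0) → first p (predFirst τ) ≡ first p τ
      first-pred-0 p e = trans (first-pred p (λ _ → 0) e) (cong (_+ first p τ) (sum₁-0 (λ _ → refl) ρ))

    -- The new entry and the raised `t` are adjacent both in position and in value. They can be the
    -- 1 and 2 of 123, with any larger third letter, or the 2 and 3 of 231, with any smaller one. In
    -- 132 the third letter would have to lie between them, and the remaining patterns begin with a
    -- descent.
    first-pred-123 : first p123 (predFirst τ) ≡ larger τ + first p123 τ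
    first-pred-123 = first-pred p123 (lt t) λ b t≢b →
      trans (cong₂ _*_ v<gt (lt-punchIn v t b)) (*-identityˡ _)

    first-pred-132 : first p132 (predFirst τ) ≡ first p132 τ
    first-pred-132 = first-pred-0 p132 λ b t≢b →
      trans (cong₂ _*_ (lt-inject₁-punchIn t b t≢b) (lt-punchIn v b t)) (lt-asym t b)

    first-pred-213 : first p213 (predFirst τ) ≡ first p213 τ
    first-pred-213 = first-pred-0 p213 λ b _ → cong (_* lt v (g b)) gt<v

    first-pred-231 : first p312 (predFirst τ) ≡ smaller τ + first p312 τ
    first-pred-231 = first-pred p312 (flip lt t) λ b _ →
      trans (cong₂ _*_ (lt-punchIn-inject₁ t b) v<gt) (*-identityʳ _)

    first-pred-312 : first p231 (predFirst τ) ≡ first p231 τ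
    first-pred-312 = first-pred-0 p231 λ b _ →
      trans (cong₂ _*_ (lt-punchIn v t b) (lt-punchIn-inject₁ t b)) (lt-asym t b)

    first-pred-321 : first p321 (predFirst τ) ≡ first p321 τ
    first-pred-321 = first-pred-0 p321 λ b _ → trans (cong (lt (g b) (g t) *_) gt<v) (*-zeroʳ (lt (g b) (g t)))

  -- Permutations avoiding 132 and 213.

  occurrences-132 : (σ : Vec (Fin n) n) → occurrences p132 σ ≡ sum₃ (χ p132) σ
  occurrences-132 = occurrences≡sum₃ p132 p132

  occurrences-213 : (σ : Vec (Fin n) n) → occurrences p213 σ ≡ sum₃ (χ p213) σ
  occurrences-213 = occurrences≡sum₃ p213 p213

  -- Avoidance is phrased with `sum₃` because that sum splits along `▸`.
  Avoider : Vec (Fin n) n → Set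
  Avoider σ = IsPermutation σ × sum₃ (χ p132) σ ≡ 0 × sum₃ (χ p213) σ ≡ 0

  ∈S[132,213]⇔Avoider : {σ : Vec (Fin n) n} → σ ∈ S[132,213] n ⇔ Avoider σ
  ∈S[132,213]⇔Avoider {n} {σ} = mk⇔ to from
    where
    avoids-both? = λ σ → avoids? {n} {3} σ p132 ×-dec avoids? σ p213
    to : σ ∈ S[132,213] n → Avoider σ
    to σ∈ with σ∈S , a , b ← ∈-filter⁻ avoids-both? {xs = S n} σ∈ =
      proj₂ (∈-filter⁻ isPermutation? {xs = words n n} σ∈S) ,
      trans (sym (occurrences-132 σ)) a , trans (sym (occurrences-213 σ)) b
    from : Avoider σ → σ ∈ S[132,213] n
    from (perm , a , b) = ∈-filter⁺ avoids-both?
      (∈-filter⁺ isPermutation? (∈-words σ) perm)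
      (trans (occurrences-132 σ) a , trans (occurrences-213 σ) b)

  avoider-tail : {v : Fin (suc n)} {τ : Vec (Fin n) n} → Avoider (v ▸ τ) → Avoider τ
  avoider-tail {v = v} {τ} (perm , a , b) =
    ▸-isPermutation⁻ perm ,
    m+n≡0⇒n≡0 (first p132 (v ▸ τ)) (trans (sym (sum₃-▸ p132 v τ)) a) ,
    m+n≡0⇒n≡0 (first p213 (v ▸ τ)) (trans (sym (sum₃-▸ p213 v τ)) b)

  maxFirst-avoider : {τ : Vec (Fin (suc n)) (suc n)} → Avoider τ → Avoider (maxFirst τ)
  maxFirst-avoider {τ = τ} (perm , a , b) =
    ▸-isPermutation perm ,
    trans (sum₃-▸ p132 _ τ) (cong₂ _+_ (first-max-132 τ) a) ,
    trans (sum₃-▸ p213 _ τ) (cong₂ _+_ (first-max-213 τ) b)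

  predFirst-avoider : {τ : Vec (Fin (suc n)) (suc n)} → Avoider τ → Avoider (predFirst τ)
  predFirst-avoider {τ = t ∷ ρ} (perm , a , b) =
    ▸-isPermutation perm ,
    trans (sum₃-▸ p132 _ (t ∷ ρ)) (cong₂ _+_ (trans (first-pred-132 t ρ t∉ρ) (m+n≡0⇒m≡0 _ a)) a) ,
    trans (sum₃-▸ p213 _ (t ∷ ρ)) (cong₂ _+_ (trans (first-pred-213 t ρ t∉ρ) (m+n≡0⇒m≡0 _ b)) b)
    where t∉ρ = head∉tail {τ = t ∷ ρ} (proj₁ perm)

  -- Triples that use the first two entries contribute summands of a vanishing sum of naturals, so
  -- each of them vanishes.
  χ-first-two : ∀ p (v : Fin (suc n)) (t : Fin n) (ρ : Vec (Fin n) k) → sum₃ (χ p) (v ▸ t ∷ ρ) ≡ 0 →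
                ∀ i → χ p v (punchIn v t) (punchIn v (lookup ρ i)) ≡ 0
  χ-first-two p v t ρ e = sum₁≡0⇒ (χ p v (punchIn v t) ∘ punchIn v) ρ
    (trans (sym (sum₁-map (punchIn v) _ ρ)) (m+n≡0⇒m≡0 _ (m+n≡0⇒m≡0 _ e)))

  -- If the first entry v is neither the maximum nor one less than the second entry,
  -- then v + 1 occurs later, and the first two entries form 213 or 132 with it.
  avoider-head : (v : Fin (suc (suc n))) (τ : Vec (Fin (suc n)) (suc n)) → Avoider (v ▸ τ) →
                 v ≡ fromℕ (suc n) ⊎ v ≡ inject₁ (head τ)
  avoider-head v (t ∷ ρ) (perm , no132 , no213) with view v
  ... | ‵fromℕ     = inj₁ refl
  ... | ‵inject₁ u with surjective⇒strictlySurjective (proj₂ (▸-isPermutation⁻ {v = v} {t ∷ ρ} perm)) u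
  ...   | zero  , t≡u = inj₂ (cong inject₁ (sym t≡u))
  ...   | suc i , refl with <-cmp t u
  ...     | tri≈ _ t≡u _ = inj₂ (cong inject₁ (sym t≡u))
  ...     | tri< t<u _ _ = contradiction
    (trans (sym (χ-first-two p213 v t ρ no213 i))
           (cong₂ _*_ (trans (lt-punchIn-inject₁ u t) (𝟙-true (t <? u) t<u)) (lt-inject₁-punchIn-refl u)))
    λ ()
  ...     | tri> _ _ u<t = contradiction
    (trans (sym (χ-first-two p132 v t ρ no132 i))
           (cong₂ _*_ (lt-inject₁-punchIn-refl u) (trans (lt-punchIn v u t) (𝟙-true (u <? t) u<t))))
    λ ()

  -- Enumeration of the avoiders.

  -- The index n stands for length n + 1: the recursion starts at length one because `predFirst`
  -- needs an existing first entry.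
  avoiders : ∀ n → List (Vec (Fin (suc n)) (suc n))
  avoiders zero    = (zero ∷ []) ∷ []
  avoiders (suc n) = List.map maxFirst (avoiders n) ++ List.map predFirst (avoiders n)

  avoiders-sound : ∀ n {σ} → σ ∈ avoiders n → Avoider σ
  avoiders-sound zero (here refl) =
    ((λ { {zero} {zero} _ → refl }) , strictlySurjective⇒surjective λ { zero → zero , refl }) ,
    refl , refl
  avoiders-sound (suc n) σ∈ with ∈-++⁻ (List.map maxFirst (avoiders n)) σ∈
  ... | inj₁ σ∈ with τ , τ∈ , refl ← ∈-map⁻ maxFirst σ∈ = maxFirst-avoider (avoiders-sound n τ∈)
  ... | inj₂ σ∈ with τ , τ∈ , refl ← ∈-map⁻ predFirst σ∈ = predFirst-avoider (avoiders-sound n τ∈)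

  avoiders-complete : ∀ n {σ} → Avoider σ → σ ∈ avoiders n
  avoiders-complete zero    {zero ∷ []} _ = here refl
  avoiders-complete (suc n) {v ∷ xs} avoider
    with τ , refl ← isPermutation⇒▸ (v ∷ xs) (proj₁ avoider)
    with avoider-head v τ avoider
  ... | inj₁ refl = ∈-++⁺ˡ (∈-map⁺ maxFirst (avoiders-complete n (avoider-tail avoider)))
  ... | inj₂ refl = ∈-++⁺ʳ _ (∈-map⁺ predFirst (avoiders-complete n (avoider-tail avoider)))

  -- The two halves are disjoint because the first entry is the maximum in one and never in the
  -- other.
  avoiders-unique : ∀ n → Unique (avoiders n)
  avoiders-unique zero    = ListAll.[] AllPairs.∷ AllPairs.[]
  avoiders-unique (suc n) = Unique.++⁺
    (Unique.map⁺ ▸-injective (avoiders-unique n))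
    (Unique.map⁺ ▸-injective (avoiders-unique n))
    λ (σ∈ , σ∈′) → disjoint (∈-map⁻ maxFirst σ∈) (∈-map⁻ predFirst σ∈′)
    where
    disjoint : ∀ {σ} → (∃ λ τ → τ ∈ avoiders n × σ ≡ maxFirst τ) →
               ¬ (∃ λ τ → τ ∈ avoiders n × σ ≡ predFirst τ)
    disjoint (_ , _ , refl) (_ , _ , e) = fromℕ≢inject₁ (∷-injectiveˡ e)

  -- Duplicate-free lists with the same members are rearrangements of each other, so sums over them
  -- agree.
  S[132,213]↭avoiders : ∀ n → S[132,213] (suc n) ↭ avoiders n
  S[132,213]↭avoiders n = ∼bag⇒↭ (unique∧set⇒bag
    (Unique.filter⁺ _ (Unique.filter⁺ isPermutation? (words-unique (suc n) (suc n))))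
    (avoiders-unique n)
    (mk⇔ (avoiders-complete n ∘ Equivalence.to ∈S[132,213]⇔Avoider)
         (Equivalence.from ∈S[132,213]⇔Avoider ∘ avoiders-sound n)))

  -- Totals over all avoiders and their recurrences.

  sum-map-+ : (g h : A → ℕ) (xs : List A) →
              sum (List.map (λ x → g x + h x) xs) ≡ sum (List.map g xs) + sum (List.map h xs)
  sum-map-+ g h []       = refl
  sum-map-+ g h (x ∷ xs) = trans (cong (g x + h x +_) (sum-map-+ g h xs))
    (solve 4 (λ a b c d → a :+ b :+ (c :+ d) := a :+ c :+ (b :+ d)) refl (g x) (h x) _ _)

  total : ∀ n → (Vec (Fin (suc n)) (suc n) → ℕ) → ℕ
  total n h = sum (List.map h (avoiders n))

  total-+ : ∀ n (g h : Vec (Fin (suc n)) (suc n) → ℕ) →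
            total n (λ σ → g σ + h σ) ≡ total n g + total n h
  total-+ n g h = sum-map-+ g h (avoiders n)

  -- The rule for `predFirst` may assume that `t` does not recur, since every listed word is a
  -- permutation.
  total-suc : ∀ n {h : Vec (Fin (suc (suc n))) (suc (suc n)) → ℕ}
              {a b : Vec (Fin (suc n)) (suc n) → ℕ} →
              (∀ τ → h (maxFirst τ) ≡ a τ) →
              (∀ t ρ → All (t ≢_) ρ → h (predFirst (t ∷ ρ)) ≡ b (t ∷ ρ)) →
              total (suc n) h ≡ total n a + total n b
  total-suc n {h} {a} {b} h-max h-pred =
    trans (cong sum (map-++ h (List.map maxFirst (avoiders n)) (List.map predFirst (avoiders n))))
    (trans (sum-++ (List.map h (List.map maxFirst (avoiders n))) _)
    (cong₂ _+_
      (cong sum (trans (sym (map-∘ (avoiders n))) (map-cong h-max (avoiders n))))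
      (cong sum (trans (sym (map-∘ (avoiders n))) (map-cong-local (ListAll.tabulate step))))))
    where
    step : ∀ {τ} → _ → h (predFirst τ) ≡ b τ
    step {t ∷ ρ} τ∈ = h-pred t ρ (head∉tail {τ = t ∷ ρ} (proj₁ (proj₁ (avoiders-sound n τ∈))))

  -- For c = 1 this counts the avoiders: there are 2ⁿ of length n + 1.
  total-const : ∀ n c → total n (λ _ → c) ≡ c * 2 ^ n
  total-const zero    c = trans (+-identityʳ c) (sym (*-identityʳ c))
  total-const (suc n) c = trans (total-suc n (λ _ → refl) (λ _ _ _ → refl))
    (trans (cong₂ _+_ (total-const n c) (total-const n c))
      (solve 2 (λ c p → c :* p :+ c :* p := c :* (con 2 :* p)) refl c (2 ^ n)))

  -- Each `τ` has exactly two extensions in the list, so the part that depends on `τ` alone is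
  -- counted twice.
  total-▸ : ∀ n {g h : Vec (Fin (suc (suc n))) (suc (suc n)) → ℕ}
            {h₀ : Vec (Fin (suc n)) (suc n) → ℕ} →
            (∀ v τ → h (v ▸ τ) ≡ g (v ▸ τ) + h₀ τ) →
            total (suc n) h ≡ total (suc n) g + (total n h₀ + total n h₀)
  total-▸ n {g} {h} {h₀} e =
    trans (total-suc n (λ τ → e _ τ) (λ t ρ _ → e _ (t ∷ ρ)))
    (trans (cong₂ _+_ (total-+ n (g ∘ maxFirst) h₀) (total-+ n (g ∘ predFirst) h₀))
    (trans (solve 4 (λ a b c d → a :+ b :+ (c :+ d) := a :+ c :+ (b :+ d)) refl
              (total n (g ∘ maxFirst)) (total n h₀) (total n (g ∘ predFirst)) (total n h₀))
           (cong (_+ (total n h₀ + total n h₀))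
              (sym (total-suc n {g} (λ _ → refl) (λ _ _ _ → refl))))))

  module _ (n : ℕ) where

    -- The summand `2 ^ n` is the one larger entry that `predFirst` adds for each avoider. In
    -- `total-smaller` it is `maxFirst` that contributes, with all n + 1 old entries below the
    -- maximum.
    total-larger : total (suc n) larger ≡ 2 ^ n + total n larger
    total-larger = trans (total-suc n larger-max (λ t ρ → larger-pred (t ∷ ρ)))
      (cong₂ _+_ (total-const n 0) (trans (total-+ n (λ _ → 1) larger)
        (cong (_+ total n larger) (trans (total-const n 1) (+-identityʳ (2 ^ n))))))

    total-smaller : total (suc n) smaller ≡ suc n * 2 ^ n + total n smaller
    total-smaller = trans (total-suc n smaller-max (λ t ρ _ → smaller-pred (t ∷ ρ)))
      (cong (_+ total n smaller) (total-const n (suc n)))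

    total-noninversions : total (suc n) noninversions ≡
                          total (suc n) larger + (total n noninversions + total n noninversions)
    total-noninversions = total-▸ n noninversions-▸

    total-inversions : total (suc n) inversions ≡
                       total (suc n) smaller + (total n inversions + total n inversions)
    total-inversions = total-▸ n inversions-▸

    total-sum₃ : ∀ p → total (suc n) (sum₃ (χ p)) ≡
                       total (suc n) (first p) + (total n (sum₃ (χ p)) + total n (sum₃ (χ p)))
    total-sum₃ p = total-▸ n (sum₃-▸ p)

    total-first-123 : total (suc n) (first p123) ≡ total n larger + total n (first p123)
    total-first-123 = trans (total-suc n first-max-123 first-pred-123)
      (cong₂ _+_ (total-const n 0) (total-+ n larger (first p123)))

    total-first-231 : total (suc n) (first p312) ≡ total n smaller + total n (first p312)
    total-first-231 = trans (total-suc n first-max-231 first-pred-231)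
      (cong₂ _+_ (total-const n 0) (total-+ n smaller (first p312)))

    total-first-312 : total (suc n) (first p231) ≡ total n noninversions + total n (first p231)
    total-first-312 = total-suc n first-max-312 first-pred-312

    total-first-321 : total (suc n) (first p321) ≡ total n inversions + total n (first p321)
    total-first-321 = total-suc n first-max-321 first-pred-321

  f≡total : ∀ q p {inverse : True (inverse? q p)} n → f q (suc n) ≡ total n (sum₃ (χ p))
  f≡total q p {inverse} n = trans (sum-↭ (map⁺ (occurrences q) (S[132,213]↭avoiders n)))
    (cong sum (map-cong (occurrences≡sum₃ q p {inverse}) (avoiders n)))

-- Embedding the naturals into the rationals.

open import Data.Integer as ℤ using (+_)
import Data.Integer.Properties as ℤ
open import Data.Rational using (ℚ; _+_; _-_; _*_; _/_; toℚᵘ; ½)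
open import Data.Rational.Properties using (toℚᵘ-injective; toℚᵘ-fromℚᵘ; toℚᵘ-homo-+; toℚᵘ-homo-*)
open import Data.Rational.Solver using (module +-*-Solver)
open import Data.Rational.Unnormalised as ℚᵘ using (mkℚᵘ; *≡*)
import Data.Rational.Unnormalised.Properties as ℚᵘ
open +-*-Solver using (Polynomial; solve; con; var; ⟦_⟧; _:+_; _:*_; _:-_; _:=_)
open Counting

ι : ℕ → ℚ
ι m = (+ m) / 1

-- Normalised fractions with variable numerators do not reduce, so identities are checked on
-- unnormalised fractions, where equality is cross-multiplication.
toℚᵘ-/ : ∀ m d → toℚᵘ ((+ m) / suc d) ℚᵘ.≃ mkℚᵘ (+ m) d
toℚᵘ-/ m d = toℚᵘ-fromℚᵘ (mkℚᵘ (+ m) d)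

ι-+ : ∀ a b → ι (a ℕ.+ b) ≡ ι a + ι b
ι-+ a b = toℚᵘ-injective (ℚᵘ.≃-trans (toℚᵘ-/ (a ℕ.+ b) 0) (ℚᵘ.≃-sym
  (ℚᵘ.≃-trans (toℚᵘ-homo-+ (ι a) (ι b))
  (ℚᵘ.≃-trans (ℚᵘ.+-cong (toℚᵘ-/ a 0) (toℚᵘ-/ b 0))
  (*≡* (cong (ℤ._* + 1) (cong₂ ℤ._+_ (ℤ.*-identityʳ (+ a)) (ℤ.*-identityʳ (+ b)))))))))

-- Splits off the denominator, so that the thirds in the theorem become a constant coefficient of a
-- polynomial.
/≡ι* : ∀ a d → (+ a) / suc d ≡ ι a * ((+ 1) / suc d)
/≡ι* a d = toℚᵘ-injective (ℚᵘ.≃-trans (toℚᵘ-/ a d) (ℚᵘ.≃-sym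
  (ℚᵘ.≃-trans (toℚᵘ-homo-* (ι a) ((+ 1) / suc d))
  (ℚᵘ.≃-trans (ℚᵘ.*-cong (toℚᵘ-/ a 0) (toℚᵘ-/ 1 d))
  (*≡* (cong₂ ℤ._*_ (ℤ.*-identityʳ (+ a)) (cong (λ e → + suc e) (sym (ℕ.+-identityʳ d)))))))))

ι-* : ∀ a b → ι (a ℕ.* b) ≡ ι a * ι b
ι-* a b = toℚᵘ-injective (ℚᵘ.≃-trans (toℚᵘ-/ (a ℕ.* b) 0) (ℚᵘ.≃-sym
  (ℚᵘ.≃-trans (toℚᵘ-homo-* (ι a) (ι b))
  (ℚᵘ.≃-trans (ℚᵘ.*-cong (toℚᵘ-/ a 0) (toℚᵘ-/ b 0))
  (*≡* (cong (ℤ._* + 1) (sym (ℤ.pos-* a b))))))))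

-- Closed forms and induction principles for them.

-- Polynomials in x = n and p = 2ⁿ, where n + 1 is the length of the permutations.
Poly : Set
Poly = Polynomial 2 → Polynomial 2 → Polynomial 2

eval : Poly → ℚ → ℚ → ℚ
eval P x p = ⟦ P (var zero) (var (suc zero)) ⟧ (x ∷ p ∷ [])

-- A record rather than a function type, so that `u` and `P` can be inferred from the type of a
-- proof.
record Closed (u : ℕ → ℕ) (P : Poly) : Set where
  constructor closed
  field
    at : ∀ n → ι (u n) ≡ eval P (ι n) (ι (2 ^ n))

open Closed

-- Passing from n to n + 1 substitutes 1 + x for x and 2p for p, which turns each induction step
-- into a polynomial identity.
eval-suc : ∀ P n → eval P (ι (suc n)) (ι (2 ^ suc n)) ≡ eval P (ι 1 + ι n) (ι 2 * ι (2 ^ n))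
eval-suc P n = cong₂ (eval P) (ι-+ 1 n) (ι-* 2 (2 ^ n))

closed-induction : ∀ {u P} → ι (u 0) ≡ eval P (ι 0) (ι 1) →
                   (∀ n → ι (u n) ≡ eval P (ι n) (ι (2 ^ n)) →
                      ι (u (suc n)) ≡ eval P (ι 1 + ι n) (ι 2 * ι (2 ^ n))) →
                   Closed u P
closed-induction {u} {P} base step = closed go
  where
  go : ∀ n → ι (u n) ≡ eval P (ι n) (ι (2 ^ n))
  go zero    = base
  go (suc n) = trans (step n (go n)) (sym (eval-suc P n))

-- Serves the statistics of the first entry. The identity is required for independent x and p, the
-- form in which a ring solver can prove it.
closed-sum : ∀ {u a P A} → ι (u 0) ≡ eval P (ι 0) (ι 1) →
             (∀ n → u (suc n) ≡ a n ℕ.+ u n) → Closed a A →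
             (∀ x p → eval A x p + eval P x p ≡ eval P (ι 1 + x) (ι 2 * p)) → Closed u P
closed-sum {u} {a} base rec a-closed e = closed-induction base λ n u-at →
  trans (cong ι (rec n)) (trans (ι-+ (a n) (u n))
  (trans (cong₂ _+_ (at a-closed n) u-at) (e (ι n) (ι (2 ^ n)))))

-- Serves the statistics of the whole permutation: the increment is a first-entry statistic of the
-- extended permutation, hence `a (suc n)`, and the old value occurs once for each extension.
closed-double : ∀ {u a P A} → ι (u 0) ≡ eval P (ι 0) (ι 1) →
                (∀ n → u (suc n) ≡ a (suc n) ℕ.+ (u n ℕ.+ u n)) → Closed a A →
                (∀ x p → eval A (ι 1 + x) (ι 2 * p) + (eval P x p + eval P x p) ≡
                         eval P (ι 1 + x) (ι 2 * p)) → Closed u P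
closed-double {u} {a} {A = A} base rec a-closed e = closed-induction base λ n u-at →
  trans (cong ι (rec n)) (trans (ι-+ (a (suc n)) (u n ℕ.+ u n))
  (trans (cong₂ _+_ (trans (at a-closed (suc n)) (eval-suc A n))
                    (trans (ι-+ (u n) (u n)) (cong₂ _+_ u-at u-at)))
         (e (ι n) (ι (2 ^ n)))))

-- Solutions of the recurrences.

shift : Poly → Poly
shift P x p = P (con (ι 1) :+ x) (con (ι 2) :* p)

-- The inhomogeneous terms in the recurrences of `larger` and `smaller`.
power scaledPower : Poly
power x p       = p
scaledPower x p = (con (ι 1) :+ x) :* p

-- Each polynomial is determined by its recurrence and the value 0 at n = 0, where the only
-- permutation has a single entry.
Larger Smaller Noninversions Inversions First123 First231 First321 Occ123 Occ231 Occ321 : Poly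
Larger        x p = p :- con (ι 1)
Smaller       x p = (x :- con (ι 1)) :* p :+ con (ι 1)
Noninversions     = Smaller
Inversions    x p = (con ½ :* x :* (x :- con (ι 1)) :+ con (ι 1)) :* p :- con (ι 1)
First123      x p = p :- con (ι 1) :- x
First231      x p = (x :- con (ι 3)) :* p :+ x :+ con (ι 3)
First321      x p = (con ½ :* x :* (x :- con (ι 5)) :+ con (ι 5)) :* p :- x :- con (ι 5)
Occ123        x p = (x :- con (ι 3)) :* p :+ x :+ con (ι 3)
Occ231        x p = (con ½ :* x :* (x :- con (ι 5)) :+ con (ι 5)) :* p :- x :- con (ι 5)
Occ321        x p =
  (con ((+ 1) / 6) :* x :* (x :* x :- con (ι 6) :* x :+ con (ι 23)) :- con (ι 7)) :* p :+ x :+ con (ι 7)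

closed-larger : Closed (λ n → total n larger) Larger
closed-larger = closed-sum {A = power} refl total-larger (closed λ n → refl)
  (solve 2 (λ x p → power x p :+ Larger x p := shift Larger x p) refl)

closed-smaller : Closed (λ n → total n smaller) Smaller
closed-smaller = closed-sum {A = scaledPower} refl total-smaller
  (closed λ n → trans (ι-* (suc n) (2 ^ n)) (cong (_* ι (2 ^ n)) (ι-+ 1 n)))
  (solve 2 (λ x p → scaledPower x p :+ Smaller x p := shift Smaller x p) refl)

closed-noninversions : Closed (λ n → total n noninversions) Noninversions
closed-noninversions = closed-double refl total-noninversions closed-larger
  (solve 2 (λ x p → shift Larger x p :+ (Noninversions x p :+ Noninversions x p) :=
                    shift Noninversions x p) refl)

closed-inversions : Closed (λ n → total n inversions) Inversions
closed-inversions = closed-double refl total-inversions closed-smaller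
  (solve 2 (λ x p → shift Smaller x p :+ (Inversions x p :+ Inversions x p) :=
                    shift Inversions x p) refl)

closed-first-123 : Closed (λ n → total n (first p123)) First123
closed-first-123 = closed-sum refl total-first-123 closed-larger
  (solve 2 (λ x p → Larger x p :+ First123 x p := shift First123 x p) refl)

closed-first-231 : Closed (λ n → total n (first p312)) First231
closed-first-231 = closed-sum refl total-first-231 closed-smaller
  (solve 2 (λ x p → Smaller x p :+ First231 x p := shift First231 x p) refl)

-- `Noninversions` and `Smaller` are the same polynomial, so 312 obeys the same recurrences as 231
-- from here on; this is why their final formulas agree.
closed-first-312 : Closed (λ n → total n (first p231)) First231
closed-first-312 = closed-sum refl total-first-312 closed-noninversions
  (solve 2 (λ x p → Noninversions x p :+ First231 x p := shift First231 x p) refl)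

closed-first-321 : Closed (λ n → total n (first p321)) First321
closed-first-321 = closed-sum refl total-first-321 closed-inversions
  (solve 2 (λ x p → Inversions x p :+ First321 x p := shift First321 x p) refl)

closed-123 : Closed (λ n → total n (sum₃ (χ p123))) Occ123
closed-123 = closed-double refl (λ n → total-sum₃ n p123) closed-first-123
  (solve 2 (λ x p → shift First123 x p :+ (Occ123 x p :+ Occ123 x p) := shift Occ123 x p) refl)

closed-231 : Closed (λ n → total n (sum₃ (χ p312))) Occ231
closed-231 = closed-double refl (λ n → total-sum₃ n p312) closed-first-231
  (solve 2 (λ x p → shift First231 x p :+ (Occ231 x p :+ Occ231 x p) := shift Occ231 x p) refl)

closed-312 : Closed (λ n → total n (sum₃ (χ p231))) Occ231
closed-312 = closed-double refl (λ n → total-sum₃ n p231) closed-first-312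
  (solve 2 (λ x p → shift First231 x p :+ (Occ231 x p :+ Occ231 x p) := shift Occ231 x p) refl)

closed-321 : Closed (λ n → total n (sum₃ (χ p321))) Occ321
closed-321 = closed-double refl (λ n → total-sum₃ n p321) closed-first-321
  (solve 2 (λ x p → shift First321 x p :+ (Occ321 x p :+ Occ321 x p) := shift Occ321 x p) refl)

ι-f : ∀ q p {inverse : True (inverse? q p)} {P} → Closed (λ n → total n (sum₃ (χ p))) P →
      ∀ n → ι (f q (suc n)) ≡ eval P (ι n) (ι (2 ^ n))
ι-f q p {inverse} total-closed n = trans (cong ι (f≡total q p {inverse} n)) (at total-closed n)

-- Translation into the stated formulas.

module _ (k : ℕ) where
  private
    -- Here n is the length. The closed forms use x = n - 1 and p = 2 ^ (n - 1), and p = 2r with r =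
    -- 2 ^ (n - 2).
    n : ℕ
    n = suc (suc k)

    x r ⅓ : ℚ
    x = ι (suc k)
    r = ι (2 ^ k)
    ⅓ = (+ 1) / 3

    n≡1+x : ι n ≡ ι 1 + x
    n≡1+x = ι-+ 1 (suc k)

    n²≡ : ι (n ^ 2) ≡ (ι 1 + x) * (ι 1 + x)
    n²≡ = trans (cong (λ m → ι (n ℕ.* m)) (ℕ.*-identityʳ n))
      (trans (ι-* n n) (cong₂ _*_ n≡1+x n≡1+x))

    n³/3≡ : (+ (n ^ 3)) / 3 ≡ (ι 1 + x) * ((ι 1 + x) * (ι 1 + x)) * ⅓
    n³/3≡ = trans (/≡ι* (n ^ 3) 2)
      (cong (_* ⅓) (trans (ι-* n (n ^ 2)) (cong₂ _*_ n≡1+x n²≡)))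

    38n/3≡ : (+ (38 ℕ.* n)) / 3 ≡ ι 38 * (ι 1 + x) * ⅓
    38n/3≡ = trans (/≡ι* (38 ℕ.* n) 2)
      (cong (_* ⅓) (trans (ι-* 38 n) (cong (ι 38 *_) n≡1+x)))

  formula-123 : eval Occ123 x (ι (2 ^ suc k)) ≡ (ι n - ι 4) * ι (2 ^ suc k) + ι n + ι 2
  formula-123 = trans
    (solve 2 (λ x p → Occ123 x p :=
        (con (ι 1) :+ x :- con (ι 4)) :* p :+ (con (ι 1) :+ x) :+ con (ι 2))
      refl x (ι (2 ^ suc k)))
    (cong (λ y → (y - ι 4) * ι (2 ^ suc k) + y + ι 2) (sym n≡1+x))

  -- Substituting p = 2r absorbs the factor ½ of `Occ231`; in `formula-321` it turns the coefficient
  -- 1/6 of `Occ321` into 1/3.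
  formula-231 : eval Occ231 x (ι (2 ^ suc k)) ≡
                (ι (n ^ 2) - ι 7 * ι n + ι 16) * r - ι n - ι 4
  formula-231 = trans (cong (eval Occ231 x) (ι-* 2 (2 ^ k))) (trans
    (solve 2 (λ x r → Occ231 x (con (ι 2) :* r) :=
        ((con (ι 1) :+ x) :* (con (ι 1) :+ x) :- con (ι 7) :* (con (ι 1) :+ x) :+ con (ι 16)) :* r
          :- (con (ι 1) :+ x) :- con (ι 4))
      refl x r)
    (cong₂ (λ s y → (s - ι 7 * y + ι 16) * r - y - ι 4) (sym n²≡) (sym n≡1+x)))

  formula-321 : eval Occ321 x (ι (2 ^ suc k)) ≡
                ((+ (n ^ 3)) / 3 - ι 3 * ι (n ^ 2) + (+ (38 ℕ.* n)) / 3 - ι 24) * r + ι n + ι 6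
  formula-321 = trans (cong (eval Occ321 x) (ι-* 2 (2 ^ k))) (trans
    (solve 2 (λ x r → Occ321 x (con (ι 2) :* r) :=
        ((con (ι 1) :+ x) :* ((con (ι 1) :+ x) :* (con (ι 1) :+ x)) :* con ⅓
          :- con (ι 3) :* ((con (ι 1) :+ x) :* (con (ι 1) :+ x))
          :+ con (ι 38) :* (con (ι 1) :+ x) :* con ⅓ :- con (ι 24)) :* r
          :+ (con (ι 1) :+ x) :+ con (ι 6))
      refl x r)
    (cong₂ (λ a y → a * r + y + ι 6)
      (cong (_- ι 24) (cong₂ _+_ (cong₂ (λ a b → a - ι 3 * b) (sym n³/3≡) (sym n²≡)) (sym 38n/3≡)))
      (sym n≡1+x)))

theorem2p10 : (n : ℕ) → n ≥ 3 →
    let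
      ι : ℕ → ℚ
      ι m = (+ m) / 1
    in
      (ι (f p123 n) ≡ (ι n - ι 4) * ι (2 ^ (n ∸ 1)) + ι n + ι 2)
      × (ι (f p231 n) ≡ (ι (n ^ 2) - ι 7 * ι n + ι 16) * ι (2 ^ (n ∸ 2)) - ι n - ι 4)
      × (ι (f p312 n) ≡ (ι (n ^ 2) - ι 7 * ι n + ι 16) * ι (2 ^ (n ∸ 2)) - ι n - ι 4)
      × (ι (f p321 n) ≡
          ((+ (n ^ 3)) / 3 - ι 3 * ι (n ^ 2) + (+ (38 ℕ.* n)) / 3 - ι 24) * ι (2 ^ (n ∸ 2))
          + ι n + ι 6)
theorem2p10 zero          ()
theorem2p10 (suc zero)    (s≤s ())
theorem2p10 (suc (suc k)) _ =
  trans (ι-f p123 p123 closed-123 (suc k)) (formula-123 k) ,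
  trans (ι-f p231 p312 closed-231 (suc k)) (formula-231 k) ,
  trans (ι-f p312 p231 closed-312 (suc k)) (formula-231 k) ,
  trans (ι-f p321 p321 closed-321 (suc k)) (formula-321 k)
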